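{- For every even integer $n\ge 4$, the $n$-prism $\Pi_n$ is edge-reflexive.
   Context: All graphs are finite. The $n$-prism $\Pi_n$ is the cubic graph of order $2n$ obtained as the Cartesian product of an $n$-cycle and $K_2$. A 3-coloring of a graph $X$ is an unordered partition $\{V_1,V_2,V_3\}$ of $V(X)$ into three independent sets (a part may be empty); the $V_i$ are the color classes of the coloring. For a 3-colorable graph $X$, the 3-coloring complex $B(X)$ is the graph whose vertices are all color classes of all 3-colorings of $X$, with two vertices $C\neq D$ joined by an edge if $C$ and $D$ are color classes of a common 3-coloring of $X$. If $X$ is a 3-colorable graph without isolated vertices, then $B(X)$ is 3-colorable and the canonical map $\phi_X(v)=\{C\in V(B(X)) : v\in C\}$, $v\in V(X)$, is a graph homomorphism $X\to B(B(X))$. The graph $X$ is reflexive if $\phi_X$ is an isomorphism. A graph $G$ is 3-edge-colorable if its line graph $L(G)$ is 3-colorable, and edge-reflexive if it is 3-edge-colorable and $L(G)$ is reflexive. -}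

module Defs where

open import Data.Bool.Base using (Bool; true; false; not; _∧_)
open import Data.Fin.Base using (Fin; zero; suc; toℕ)
open import Data.Fin.Properties using (all?; _≟_)
open import Data.Nat.Base using (ℕ; suc; _≤_; s≤s)
open import Data.Nat.Properties using (1+n≢n)
open import Data.Product.Base using (∃; ∃-syntax; _×_; _,_; proj₁; proj₂)
open import Data.Product.Relation.Binary.Pointwise.NonDependent using (×-setoid)
open import Data.Sum.Base as Sum using (_⊎_; inj₁; inj₂)
open import Function.Bundles using (Func; _⟨$⟩_)
open import Function.Definitions using (Congruent; Bijective)
import Function.Relation.Binary.Setoid.Equality as FuncEq
open import Level using (0ℓ)
open import Relation.Binary.Bundles using (Setoid)
open import Relation.Binary.Core using (Rel)
open import Relation.Binary.Definitions using (Symmetric; Irreflexive)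
open import Relation.Binary.PropositionalEquality
  using (_≡_; _≢_; refl; sym; trans; cong; cong₂; setoid; ≢-sym)
open import Relation.Nullary using (¬_; contradiction)
open import Relation.Nullary.Decidable using (toWitness; ¬?; _→-dec_)

-- Vertices form a setoid, because vertices of line graphs are unordered pairs
-- and vertices of 3-coloring complexes are subsets. Finiteness is not a field:
-- the constructions below do not need it, and line graphs and 3-coloring
-- complexes of finite graphs are again finite.
record Graph : Set₁ where
  field
    vertices : Setoid 0ℓ 0ℓ
  open Setoid vertices public
    using (_≈_)
    renaming (Carrier to V; refl to ≈-refl; sym to ≈-sym; trans to ≈-trans)
  field
    Adj        : Rel V 0ℓ
    adj-resp   : ∀ {u u′ v v′} → u ≈ u′ → v ≈ v′ → Adj u v → Adj u′ v′
    adj-sym    : Symmetric Adj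
    adj-irrefl : Irreflexive _≈_ Adj

open Graph using (vertices; V; Adj)

NoIsolated : Graph → Set
NoIsolated X = (v : V X) → ∃[ u ] Adj X v u

record IsHomomorphism (X Y : Graph) (f : V X → V Y) : Set where
  field
    congruent : Congruent (Graph._≈_ X) (Graph._≈_ Y) f
    preserves : ∀ {u v} → Adj X u v → Adj Y (f u) (f v)

record IsIsomorphism (X Y : Graph) (f : V X → V Y) : Set where
  field
    isHomomorphism : IsHomomorphism X Y f
    bijective      : Bijective (Graph._≈_ X) (Graph._≈_ Y) f
    reflects       : ∀ {u v} → Adj Y (f u) (f v) → Adj X u v

------------------------------------------------------------------------
-- 3-colorings

-- A subset is a characteristic function respecting equality of vertices.
Subset : Setoid 0ℓ 0ℓ → Set
Subset A = Func A (setoid Bool)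

infix 4 _∈_ _≐_

_∈_ : {A : Setoid 0ℓ 0ℓ} → Setoid.Carrier A → Subset A → Set
v ∈ S = S ⟨$⟩ v ≡ true

_≐_ : {A : Setoid 0ℓ 0ℓ} → Subset A → Subset A → Set
_≐_ {A} = FuncEq._≈_ A (setoid Bool)

Independent : (X : Graph) → Subset (vertices X) → Set
Independent X S = ∀ {u v} → u ∈ S → v ∈ S → ¬ Adj X u v

-- The parts of an unordered partition {V₁,V₂,V₃}, listed in some order and
-- possibly empty. Colorings are used only through IsClassOf below, which does
-- not depend on the order.
record ThreeColoring (X : Graph) : Set where
  field
    part        : Fin 3 → Subset (vertices X)
    cover       : ∀ v → ∃[ i ] v ∈ part i
    disjoint    : ∀ {v i j} → v ∈ part i → v ∈ part j → i ≡ j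
    independent : ∀ i → Independent X (part i)

open ThreeColoring

ThreeColorable : Graph → Set
ThreeColorable X = ThreeColoring X

IsClassOf : {X : Graph} → Subset (vertices X) → ThreeColoring X → Set
IsClassOf C c = ∃[ i ] C ≐ part c i

IsColorClass : (X : Graph) → Subset (vertices X) → Set
IsColorClass X C = ∃[ c ] IsClassOf {X} C c

-- The 3-coloring complex.
B : Graph → Graph
B X = record
  { vertices = record
    { Carrier       = ∃[ C ] IsColorClass X C
    ; _≈_           = λ C D → proj₁ C ≐ proj₁ D
    ; isEquivalence = record
      { refl  = λ _ → refl
      ; sym   = λ C≐D v → sym (C≐D v)
      ; trans = λ C≐D D≐E v → trans (C≐D v) (D≐E v)
      }
    }
  ; Adj = λ C D → ¬ (proj₁ C ≐ proj₁ D) ×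
                  (∃[ c ] IsClassOf {X} (proj₁ C) c × IsClassOf {X} (proj₁ D) c)
  ; adj-resp = λ C≐C′ D≐D′ (C≠D , c , (i , C≐i) , (j , D≐j)) →
        (λ C′≐D′ → C≠D (λ v → trans (C≐C′ v) (trans (C′≐D′ v) (sym (D≐D′ v)))))
      , c
      , (i , λ v → trans (sym (C≐C′ v)) (C≐i v))
      , (j , λ v → trans (sym (D≐D′ v)) (D≐j v))
  ; adj-sym    = λ (C≠D , c , p , q) → (λ D≐C → C≠D (λ v → sym (D≐C v))) , c , q , p
  ; adj-irrefl = λ C≐D (C≠D , _) → C≠D C≐D
  }

------------------------------------------------------------------------
-- The canonical map

-- {C ∈ V(B(X)) : v ∈ C}
star : (X : Graph) → V X → Subset (vertices (B X))
star X v = record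
  { to   = λ (C , _) → C ⟨$⟩ v
  ; cong = λ C≐D → C≐D v
  }

-- An edge uv of X yields a 3-coloring of B(X): in every 3-coloring of X, one
-- class contains u, another contains v, and the third contains neither.
module _ (X : Graph) {u v : V X} (uv : Adj X u v) where
  private
    neither : Subset (vertices (B X))
    neither = record
      { to   = λ (C , _) → not (C ⟨$⟩ u) ∧ not (C ⟨$⟩ v)
      ; cong = λ C≐D → cong₂ (λ a b → not a ∧ not b) (C≐D u) (C≐D v)
      }

    parts : Fin 3 → Subset (vertices (B X))
    parts zero             = star X u
    parts (suc zero)       = star X v
    parts (suc (suc zero)) = neither

    not-both : (C : V (B X)) → u ∈ proj₁ C → ¬ v ∈ proj₁ C
    not-both (C , c , i , C≐i) u∈C v∈C = independent c i
      (trans (sym (C≐i u)) u∈C) (trans (sym (C≐i v)) v∈C) uv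

    ∉-neither : ∀ {a b} → not a ∧ not b ≡ true → a ≢ true × b ≢ true
    ∉-neither {false} {false} _ = (λ ()) , (λ ())

    covers : ∀ C → ∃[ i ] C ∈ parts i
    covers (C , _) with C ⟨$⟩ u in eqᵤ | C ⟨$⟩ v in eqᵥ
    ... | true  | _     = zero , eqᵤ
    ... | false | true  = suc zero , eqᵥ
    ... | false | false =
      suc (suc zero) , cong₂ (λ a b → not a ∧ not b) eqᵤ eqᵥ

    disjoints : ∀ C i j → C ∈ parts i → C ∈ parts j → i ≡ j
    disjoints C zero zero p q = refl
    disjoints C zero (suc zero) p q = contradiction q (not-both C p)
    disjoints C zero (suc (suc zero)) p q = contradiction p (proj₁ (∉-neither q))
    disjoints C (suc zero) zero p q = contradiction p (not-both C q)
    disjoints C (suc zero) (suc zero) p q = refl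
    disjoints C (suc zero) (suc (suc zero)) p q = contradiction p (proj₂ (∉-neither q))
    disjoints C (suc (suc zero)) zero p q = contradiction q (proj₁ (∉-neither p))
    disjoints C (suc (suc zero)) (suc zero) p q = contradiction q (proj₂ (∉-neither p))
    disjoints C (suc (suc zero)) (suc (suc zero)) p q = refl

    star-independent : ∀ w → Independent (B X) (star X w)
    star-independent w {C , _} {D , _} w∈C w∈D (C≠D , c , (i , C≐i) , (j , D≐j))
      with disjoint c {w} {i} {j} (trans (sym (C≐i w)) w∈C) (trans (sym (D≐j w)) w∈D)
    ... | refl = C≠D (λ x → trans (C≐i x) (sym (D≐j x)))

    third-unique : (i j k l : Fin 3) → i ≢ j → i ≢ k → j ≢ k → i ≢ l → j ≢ l → k ≡ l
    third-unique = toWitness {a? = all? λ i → all? λ j → all? λ k → all? λ l →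
      ¬? (i ≟ j) →-dec ¬? (i ≟ k) →-dec ¬? (j ≟ k) →-dec
      ¬? (i ≟ l) →-dec ¬? (j ≟ l) →-dec (k ≟ l)} _

    neither-independent : Independent (B X) neither
    neither-independent {C , _} {D , _} p q (C≠D , c , (k , C≐k) , (l , D≐l))
      with cover c u | cover c v
    ... | i , u∈i | j , v∈j
      with third-unique i j k l
             (λ { refl → independent c i u∈i v∈j uv })
             (λ { refl → proj₁ (∉-neither p) (trans (C≐k u) u∈i) })
             (λ { refl → proj₂ (∉-neither p) (trans (C≐k v) v∈j) })
             (λ { refl → proj₁ (∉-neither q) (trans (D≐l u) u∈i) })
             (λ { refl → proj₂ (∉-neither q) (trans (D≐l v) v∈j) })
    ... | refl = C≠D (λ x → trans (C≐k x) (sym (D≐l x)))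

    independents : ∀ i → Independent (B X) (parts i)
    independents zero             {C} {D} = star-independent u {C} {D}
    independents (suc zero)       {C} {D} = star-independent v {C} {D}
    independents (suc (suc zero)) {C} {D} = neither-independent {C} {D}

  edgeColoring : ThreeColoring (B X)
  edgeColoring = record
    { part        = parts
    ; cover       = covers
    ; disjoint    = λ {C} {i} {j} → disjoints C i j
    ; independent = independents
    }

  star-classˡ : IsClassOf (star X u) edgeColoring
  star-classˡ = zero , λ _ → refl

  star-classʳ : IsClassOf (star X v) edgeColoring
  star-classʳ = suc zero , λ _ → refl

φ : (X : Graph) → NoIsolated X → V X → V (B (B X))
φ X nonIso v = let (_ , vu) = nonIso v in
  star X v , edgeColoring X vu , star-classˡ X vu

φ-isHomomorphism : (X : Graph) → ThreeColorable X → (nonIso : NoIsolated X) →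
                   IsHomomorphism X (B (B X)) (φ X nonIso)
φ-isHomomorphism X c nonIso = record
  { congruent = λ u≈v (C , _) → Func.cong C u≈v
  ; preserves = λ {u} {v} uv →
      (λ eq → let (i , u∈i) = cover c u in
        independent c i u∈i
          (trans (sym (eq (part c i , c , i , λ _ → refl))) u∈i) uv)
    , edgeColoring X uv , star-classˡ X uv , star-classʳ X uv
  }

record IsReflexive (X : Graph) : Set where
  field
    threeColorable : ThreeColorable X
    noIsolated     : NoIsolated X
    φ-isomorphism  : IsIsomorphism X (B (B X)) (φ X noIsolated)

------------------------------------------------------------------------
-- Line graphs

-- An edge is an ordered pair of adjacent vertices, identified with its reversal.
module _ (G : Graph) where
  open Graph G using (_≈_; ≈-refl; ≈-sym; ≈-trans; adj-sym)

  Edge : Set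
  Edge = ∃[ u ] ∃[ v ] Adj G u v

  infix 4 _≈ₑ_

  _≈ₑ_ : Edge → Edge → Set
  (u , v , _) ≈ₑ (u′ , v′ , _) = (u ≈ u′ × v ≈ v′) ⊎ (u ≈ v′ × v ≈ u′)

  Incident : V G → Edge → Set
  Incident w (u , v , _) = w ≈ u ⊎ w ≈ v

  private
    symₑ : ∀ {e f} → e ≈ₑ f → f ≈ₑ e
    symₑ (inj₁ (p , q)) = inj₁ (≈-sym p , ≈-sym q)
    symₑ (inj₂ (p , q)) = inj₂ (≈-sym q , ≈-sym p)

    transₑ : ∀ {e f g} → e ≈ₑ f → f ≈ₑ g → e ≈ₑ g
    transₑ (inj₁ (p , q)) (inj₁ (r , s)) = inj₁ (≈-trans p r , ≈-trans q s)
    transₑ (inj₁ (p , q)) (inj₂ (r , s)) = inj₂ (≈-trans p r , ≈-trans q s)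
    transₑ (inj₂ (p , q)) (inj₁ (r , s)) = inj₂ (≈-trans p s , ≈-trans q r)
    transₑ (inj₂ (p , q)) (inj₂ (r , s)) = inj₁ (≈-trans p s , ≈-trans q r)

    incident-resp : ∀ {w e f} → e ≈ₑ f → Incident w e → Incident w f
    incident-resp (inj₁ (p , q)) (inj₁ r) = inj₁ (≈-trans r p)
    incident-resp (inj₁ (p , q)) (inj₂ r) = inj₂ (≈-trans r q)
    incident-resp (inj₂ (p , q)) (inj₁ r) = inj₂ (≈-trans r p)
    incident-resp (inj₂ (p , q)) (inj₂ r) = inj₁ (≈-trans r q)

  L : Graph
  L = record
    { vertices = record
      { Carrier       = Edge
      ; _≈_           = _≈ₑ_
      ; isEquivalence = record
        { refl  = inj₁ (≈-refl , ≈-refl)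
        ; sym   = λ {e} {f} → symₑ {e} {f}
        ; trans = λ {e} {f} {g} → transₑ {e} {f} {g}
        }
      }
    ; Adj = λ e f → ¬ (e ≈ₑ f) × (∃[ w ] Incident w e × Incident w f)
    ; adj-resp = λ {e} {e′} {f} {f′} e≈e′ f≈f′ (e≠f , w , p , q) →
          (λ e′≈f′ → e≠f (transₑ {e} {e′} {f} e≈e′
                           (transₑ {e′} {f′} {f} e′≈f′ (symₑ {f} {f′} f≈f′))))
        , w , incident-resp {w} {e} {e′} e≈e′ p , incident-resp {w} {f} {f′} f≈f′ q
    ; adj-sym = λ {e} {f} (e≠f , w , p , q) →
        (λ f≈e → e≠f (symₑ {f} {e} f≈e)) , w , q , p
    ; adj-irrefl = λ e≈f (e≠f , _) → e≠f e≈f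
    }

ThreeEdgeColorable : Graph → Set
ThreeEdgeColorable G = ThreeColorable (L G)

EdgeReflexive : Graph → Set
EdgeReflexive G = ThreeEdgeColorable G × IsReflexive (L G)

------------------------------------------------------------------------
-- Prisms

K : ℕ → Graph
K n = record
  { vertices   = setoid (Fin n)
  ; Adj        = _≢_
  ; adj-resp   = λ { refl refl p → p }
  ; adj-sym    = ≢-sym
  ; adj-irrefl = λ p q → q p
  }

-- j is the cyclic successor of i.
Next : ∀ {n} → Fin n → Fin n → Set
Next {n} i j = toℕ j ≡ suc (toℕ i) ⊎ (suc (toℕ i) ≡ n × toℕ j ≡ 0)

Cycle : (n : ℕ) → 3 ≤ n → Graph
Cycle n 3≤n = record
  { vertices   = setoid (Fin n)
  ; Adj        = λ i j → Next i j ⊎ Next j i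
  ; adj-resp   = λ { refl refl p → p }
  ; adj-sym    = Sum.swap
  ; adj-irrefl = λ { refl → Sum.[ irrefl 3≤n , irrefl 3≤n ] }
  }
  where
  irrefl : ∀ {n} → 3 ≤ n → {i : Fin n} → ¬ Next i i
  irrefl _              (inj₁ p)       = 1+n≢n (sym p)
  irrefl (s≤s (s≤s _)) (inj₂ (p , q)) with trans (sym p) (cong suc q)
  ... | ()

infixr 7 _□_

-- Cartesian product.
_□_ : Graph → Graph → Graph
G □ H = record
  { vertices = ×-setoid (vertices G) (vertices H)
  ; Adj = λ (a , b) (c , d) → (a G.≈ c × H.Adj b d) ⊎ (G.Adj a c × b H.≈ d)
  ; adj-resp = λ (p , q) (r , s) → Sum.map
      (λ (x , y) → G.≈-trans (G.≈-sym p) (G.≈-trans x r) , H.adj-resp q s y)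
      (λ (x , y) → G.adj-resp p r x , H.≈-trans (H.≈-sym q) (H.≈-trans y s))
  ; adj-sym = Sum.map
      (λ (x , y) → G.≈-sym x , H.adj-sym y)
      (λ (x , y) → G.adj-sym x , H.≈-sym y)
  ; adj-irrefl = λ (p , q) → Sum.[ (λ (_ , y) → H.adj-irrefl q y)
                                 , (λ (x , _) → G.adj-irrefl p x) ]
  }
  where
  module G = Graph G
  module H = Graph H

Prism : (n : ℕ) → 3 ≤ n → Graph
Prism n 3≤n = Cycle n 3≤n □ K 2

{-# OPTIONS --safe #-}
-- In a 3-edge-coloring of an even prism the two rails either carry the same
-- proper coloring of the n-cycle, which then determines the rungs, or alternate
-- two colors in opposite phase, all rungs having the third color.
--
-- Let f be a 3-coloring of the 3-coloring complex, and consider the color t that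
-- f gives to the even edges E of the cycle. Among the classes of a coloring of
-- the first kind exactly one has color t. Comparing the cycle colorings
-- {A, E ∖ A, O ∖ A}, {A ∩ E, E ∖ A, O} and {E, O ∩ A, O ∖ A} shows that whether A
-- has color t depends only on A ∩ E. Every 3-partition of E is the trace of a
-- proper coloring of the cycle, so the traces of color t form an ultrafilter, and
-- the classes of color t are those containing a fixed edge i of E. Similarly, the
-- classes with the color of the odd edges O are those containing an edge j of O.
-- The edges i and j are consecutive, since otherwise some class contains both,
-- so the third color of f belongs to the rung between i and j. The colorings of
-- the second kind decide on which rail the edges over i and j lie.

module Submission where

open import Defs
open import Data.Bool.Base using (Bool; T; true; false; not; _∨_; if_then_else_)
open import Data.Bool.Properties as Bool using (⇔→≡; not-involutive; ∨-zeroʳ)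
open import Data.Fin.Base using (Fin; zero; suc; toℕ; fromℕ; fromℕ<; inject₁)
open import Data.Fin.Induction using (<-weakInduction)
open import Data.Fin.Patterns using (0F; 1F; 2F)
open import Data.Fin.Properties
  using (all?; _≟_; toℕ-injective; toℕ-fromℕ; toℕ-fromℕ<; toℕ-inject₁; toℕ<n)
open import Data.Nat.Base using (ℕ; zero; suc; _*_; _≤_; _<_; s≤s; _<ᵇ_; _≡ᵇ_)
open import Data.Nat.Divisibility using (_∣_; divides)
open import Data.Nat.Properties
  using (<⇒≤; _<?_; ≮⇒≥; ≤-antisym; ≤-refl; suc-injective; <⇒≢; m≢1+n+m; ≡ᵇ⇒≡)
open import Data.Product.Base using (∃-syntax; _×_; _,_; proj₁; proj₂)
open import Data.Sum.Base using (_⊎_; inj₁; inj₂)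
open import Function.Base using (_∘_)
open import Function.Bundles using (Func; mk⇔; _⟨$⟩_)
open import Relation.Binary.PropositionalEquality
  using (_≡_; _≢_; refl; sym; trans; cong; cong₂; subst; ≢-sym)
open import Relation.Nullary using (¬_; contradiction; does; yes; no)
open import Relation.Nullary.Decidable
  using (toWitness; ¬?; _→-dec_; _⊎-dec_; dec-true; dec-false)

infix 4 _==_

-- Colors and color classes.

_==_ : ∀ {k} → Fin k → Fin k → Bool
a == b = does (a ≟ b)

==⇒≡ : ∀ {k} {a b : Fin k} → (a == b) ≡ true → a ≡ b
==⇒≡ {a = a} {b} p with a ≟ b
... | yes a≡b = a≡b

==-refl : ∀ {k} (a : Fin k) → (a == a) ≡ true
==-refl a = dec-true (a ≟ a) refl

==-false : ∀ {k} {a b : Fin k} → a ≢ b → (a == b) ≡ false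
==-false {a = a} {b} = dec-false (a ≟ b)

abstract
  remaining-unique : (a b c d : Fin 3) → a ≢ b → c ≢ a → c ≢ b → d ≢ a → d ≢ b → c ≡ d
  remaining-unique = toWitness {a? = all? λ a → all? λ b → all? λ c → all? λ d →
    ¬? (a ≟ b) →-dec ¬? (c ≟ a) →-dec ¬? (c ≟ b) →-dec
    ¬? (d ≟ a) →-dec ¬? (d ≟ b) →-dec (c ≟ d)} _

abstract
  distinct-exhaust : (a b c d : Fin 3) → a ≢ b → a ≢ c → b ≢ c → d ≡ a ⊎ d ≡ b ⊎ d ≡ c
  distinct-exhaust = toWitness {a? = all? λ a → all? λ b → all? λ c → all? λ d →
    ¬? (a ≟ b) →-dec ¬? (a ≟ c) →-dec ¬? (b ≟ c) →-dec
    ((d ≟ a) ⊎-dec (d ≟ b) ⊎-dec (d ≟ c))} _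

-- Differs from both arguments even when they coincide. `extend` relies on this, since the two
-- neighbors of an odd edge may have the same color.
third : Fin 3 → Fin 3 → Fin 3
third 0F 1F = 2F
third 1F 0F = 2F
third 0F _  = 1F
third _  0F = 1F
third _  _  = 0F

abstract
  third≢ˡ : ∀ a b → third a b ≢ a
  third≢ˡ = toWitness {a? = all? λ a → all? λ b → ¬? (third a b ≟ a)} _

abstract
  third≢ʳ : ∀ a b → third a b ≢ b
  third≢ʳ = toWitness {a? = all? λ a → all? λ b → ¬? (third a b ≟ b)} _

third-unique : ∀ {a b c} → a ≢ b → c ≢ a → c ≢ b → third a b ≡ c
third-unique {a} {b} {c} a≢b = remaining-unique a b _ c a≢b (third≢ˡ a b) (third≢ʳ a b)

-- Only the two indicated classes are compared; the rest may be divided differently. A record rather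
-- than a pointwise equation, so that colorings and labels can be inferred from a proof.
record SameClass {A : Set} (x : A → Fin 3) (k : Fin 3) (x′ : A → Fin 3) (k′ : Fin 3) : Set where
  constructor sameClass
  field
    agree : ∀ a → (x a == k) ≡ (x′ a == k′)

open SameClass

SameClass-sym : ∀ {A : Set} {x k x′ k′} → SameClass {A} x k x′ k′ → SameClass x′ k′ x k
SameClass-sym p .agree a = sym (p .agree a)

-- Ultrafilters on a finite set, in terms of 3-partitions.

<ᵇ-suc : ∀ i t → (i <ᵇ suc t) ≡ (i <ᵇ t) ∨ (i ≡ᵇ t)
<ᵇ-suc zero    zero    = refl
<ᵇ-suc zero    (suc t) = refl
<ᵇ-suc (suc i) zero    = refl
<ᵇ-suc (suc i) (suc t) = <ᵇ-suc i t

<ᵇ-irrefl : ∀ t → (t <ᵇ t) ≡ false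
<ᵇ-irrefl zero    = refl
<ᵇ-irrefl (suc t) = <ᵇ-irrefl t

toℕ<ᵇn : ∀ {n} (i : Fin n) → (toℕ i <ᵇ n) ≡ true
toℕ<ᵇn zero    = refl
toℕ<ᵇn (suc i) = toℕ<ᵇn i

toℕ-≡ᵇ : ∀ {n t} (t<n : t < n) i → (toℕ i ≡ᵇ t) ≡ (i == fromℕ< t<n)
toℕ-≡ᵇ {t = zero}  (s≤s t<n) zero    = refl
toℕ-≡ᵇ {t = zero}  (s≤s t<n) (suc i) = refl
toℕ-≡ᵇ {t = suc t} (s≤s t<n) zero    = refl
toℕ-≡ᵇ {t = suc t} (s≤s t<n) (suc i) = toℕ-≡ᵇ t<n i

-- The chosen blocks of labelled 3-partitions form an ultrafilter, and on a
-- finite set ultrafilters are principal.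
module Principal {n} (H : (Fin n → Fin 3) → Fin 3)
  (coherent : ∀ {y k y′ k′} → SameClass y k y′ k′ → H y ≡ k → H y′ ≡ k′) where

  private
    -- An empty class matches both empty classes `1F` and `2F` of a constant labelling, so `H` would
    -- take two values there.
    nonempty : ∀ {y k} → H y ≡ k → ¬ (∀ i → (y i == k) ≡ false)
    nonempty {y} {k} Hy≡k empty with
        trans (sym (coherent {y′ = λ _ → 0F} {1F} (sameClass empty) Hy≡k))
              (coherent {y′ = λ _ → 0F} {2F} (sameClass empty) Hy≡k)
    ... | ()

    cut : ℕ → Fin n → Fin 3
    cut t i = if toℕ i <ᵇ t then 0F else 1F

    -- The common refinement of `cut t` and `cut (suc t)`, with position `t` alone in block `1F`.
    cut₃ : ℕ → Fin n → Fin 3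
    cut₃ t i = if toℕ i <ᵇ t then 0F else (if toℕ i ≡ᵇ t then 1F else 2F)

    cut₃-0 : ∀ t → SameClass (cut₃ t) 0F (cut t) 0F
    cut₃-0 t .agree i with toℕ i <ᵇ t | toℕ i ≡ᵇ t
    ... | true  | _     = refl
    ... | false | true  = refl
    ... | false | false = refl

    cut₃-2 : ∀ t → SameClass (cut₃ t) 2F (cut (suc t)) 1F
    cut₃-2 t .agree i rewrite <ᵇ-suc (toℕ i) t with toℕ i <ᵇ t | toℕ i ≡ᵇ t
    ... | true  | _     = refl
    ... | false | true  = refl
    ... | false | false = refl

    -- With `U` arbitrary, the singleton of `j` competes against any given set that avoids `j`.
    isolate : Fin n → (Fin n → Bool) → Fin n → Fin 3
    isolate j U i = if i == j then 1F else (if U i then 0F else 2F)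

    isolate-1 : ∀ {j y k} U → (∀ i → (y i == k) ≡ (i == j)) →
                SameClass y k (isolate j U) 1F
    isolate-1 {j} U p .agree i rewrite p i with i == j | U i
    ... | true  | _     = refl
    ... | false | true  = refl
    ... | false | false = refl

    cut₃-1 : ∀ {t} (t<n : t < n) i → (cut₃ t i == 1F) ≡ (i == fromℕ< t<n)
    cut₃-1 {t} t<n i rewrite sym (toℕ-≡ᵇ t<n i)
      with toℕ i <ᵇ t in lt | toℕ i ≡ᵇ t in eq
    ... | false | true  = refl
    ... | false | false = refl
    ... | true  | false = refl
    ... | true  | true
      with refl ← ≡ᵇ⇒≡ (toℕ i) t (subst T (sym eq) _)
      with () ← trans (sym lt) (<ᵇ-irrefl (toℕ i))

    Pivot : Fin n → Set
    Pivot j = ∀ U → H (isolate j U) ≡ 1F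

    -- A discrete intermediate value argument, descending in `t`: where `H` stops choosing the
    -- initial segment, both outer blocks of `cut₃` are excluded and the singleton remains.
    findPivot : ∀ t → t ≤ n → H (cut t) ≡ 0F → ∃[ j ] Pivot j
    findPivot zero    _   h = contradiction (λ _ → refl) (nonempty h)
    findPivot (suc t) t<n h with H (cut t) ≟ 0F
    ... | yes h′ = findPivot t (<⇒≤ t<n) h′
    ... | no ¬h′ = fromℕ< t<n , λ U →
      coherent (isolate-1 U (cut₃-1 t<n)) H-cut₃
      where
      H-cut₃ : H (cut₃ t) ≡ 1F
      H-cut₃ with H (cut₃ t) in eq
      ... | 0F = contradiction (coherent (cut₃-0 t) eq) ¬h′
      ... | 1F = refl
      ... | 2F with () ← trans (sym h) (coherent (cut₃-2 t) eq)

    cut-n : H (cut n) ≡ 0F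
    cut-n with H (cut n) in eq
    ... | 0F = refl
    ... | 1F = contradiction
      (λ i → cong (λ b → _==_ {3} (if b then 0F else 1F) 1F) (toℕ<ᵇn i)) (nonempty eq)
    ... | 2F = contradiction
      (λ i → cong (λ b → _==_ {3} (if b then 0F else 1F) 2F) (toℕ<ᵇn i)) (nonempty eq)

    pivot : ∃[ j ] Pivot j
    pivot = findPivot n ≤-refl cut-n

  abstract
    principal : ∃[ j ] ∀ y → H y ≡ y j
    principal with pivot
    ... | j , piv = j , at-j
      where
      at-j : ∀ y → H y ≡ y j
      at-j y with y j ≟ H y
      ... | yes p = sym p
      -- Otherwise the chosen block of `y` misses `j`, hence is block `0F` of a partition in which
      -- `H` chooses the singleton of `j`.
      ... | no ¬p =
        contradiction (trans (sym (piv (λ i → y i == H y))) (coherent same refl)) λ ()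
        where
        same : SameClass y (H y) (isolate j (λ i → y i == H y)) 0F
        same .agree i with i ≟ j
        ... | yes refl = ==-false ¬p
        ... | no _ with y i == H y
        ... | true  = refl
        ... | false = refl

-- Parity and the cyclic successor.

even : ℕ → Bool
even zero    = true
even (suc k) = not (even k)

even-2* : ∀ k → even (k * 2) ≡ true
even-2* zero    = refl
even-2* (suc k) = trans (not-involutive (even (k * 2))) (even-2* k)

-- The bound matters: in a cycle of length two each vertex is the successor of the other. Later this
-- excludes parallel edges.
Next-asym : ∀ {n} {i j : Fin n} → 3 ≤ n → Next i j → ¬ Next j i
Next-asym _ (inj₁ p) (inj₁ q) = contradiction (trans p (cong suc q)) (m≢1+n+m _ {1})
Next-asym (s≤s (s≤s (s≤s _))) (inj₁ p) (inj₂ (q , r))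
  with () ← trans (sym q) (cong suc (trans p (cong suc r)))
Next-asym (s≤s (s≤s (s≤s _))) (inj₂ (p , q)) (inj₁ r)
  with () ← trans (sym p) (cong suc (trans r (cong suc q)))
Next-asym (s≤s (s≤s (s≤s _))) (inj₂ (p , q)) (inj₂ (r , s))
  with () ← trans (sym p) (cong suc s)

Next-functional : ∀ {n} {i j k : Fin n} → Next i j → Next i k → j ≡ k
Next-functional (inj₁ p) (inj₁ q) = toℕ-injective (trans p (sym q))
Next-functional {j = j} (inj₁ p) (inj₂ (q , _)) =
  contradiction (trans p q) (<⇒≢ (toℕ<n j))
Next-functional {k = k} (inj₂ (p , _)) (inj₁ q) =
  contradiction (trans q p) (<⇒≢ (toℕ<n k))
Next-functional (inj₂ (_ , p)) (inj₂ (_ , q)) = toℕ-injective (trans p (sym q))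

Next-injective : ∀ {n} {i j k : Fin n} → Next i k → Next j k → i ≡ j
Next-injective (inj₁ p) (inj₁ q) = toℕ-injective (suc-injective (trans (sym p) q))
Next-injective (inj₁ p) (inj₂ (_ , q)) with () ← trans (sym p) q
Next-injective (inj₂ (_ , p)) (inj₁ q) with () ← trans (sym p) q
Next-injective (inj₂ (p , _)) (inj₂ (q , _)) =
  toℕ-injective (suc-injective (trans p (sym q)))

module EvenCycle {m} (3≤n : 3 ≤ suc m) (n-even : even (suc m) ≡ true) where

  I : Set
  I = Fin (suc m)

  private
    successor : (i : I) → ∃[ j ] Next i j
    successor i with suc (toℕ i) <? suc m
    ... | yes p = fromℕ< p , inj₁ (toℕ-fromℕ< p)
    ... | no ¬p = zero , inj₂ (≤-antisym (toℕ<n i) (≮⇒≥ ¬p) , refl)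

    predecessor : (i : I) → ∃[ j ] Next j i
    predecessor zero    = fromℕ m , inj₂ (cong suc (toℕ-fromℕ m) , refl)
    predecessor (suc i) = inject₁ i , inj₁ (cong suc (sym (toℕ-inject₁ i)))

  next prev : I → I
  next i = proj₁ (successor i)
  prev i = proj₁ (predecessor i)

  next-Next : ∀ i → Next i (next i)
  next-Next i = proj₂ (successor i)

  Next⇒≡ : ∀ {i j} → Next i j → j ≡ next i
  Next⇒≡ p = Next-functional p (next-Next _)

  next-prev : ∀ i → next (prev i) ≡ i
  next-prev i = sym (Next⇒≡ (proj₂ (predecessor i)))

  next-injective : ∀ {i j} → next i ≡ next j → i ≡ j
  next-injective {i} {j} p =
    Next-injective (next-Next i) (subst (Next j) (sym p) (next-Next j))

  prev-next : ∀ i → prev (next i) ≡ i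
  prev-next i = next-injective (next-prev (next i))

  next-next≢ : ∀ i → next (next i) ≢ i
  next-next≢ i p = Next-asym 3≤n (next-Next i) (subst (Next (next i)) p (next-Next (next i)))

  next-induction : (P : I → Set) → P zero → (∀ i → P i → P (next i)) → ∀ i → P i
  next-induction P P₀ step = <-weakInduction P P₀ λ i p →
    subst P (sym (Next⇒≡ (inj₁ (cong suc (sym (toℕ-inject₁ i)))))) (step _ p)

  par : I → Bool
  par i = even (toℕ i)

  par-next : ∀ i → par (next i) ≡ not (par i)
  par-next i with next-Next i
  ... | inj₁ p       = cong even p
  -- The only use of `n-even`: the wraparound leads from an odd last index to `0`.
  ... | inj₂ (p , q) = trans (cong even q) (sym (trans (cong even p) n-even))

  next≢ : ∀ i → next i ≢ i
  next≢ i p with par i | par-next i | cong par p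
  ... | true  | q | r with () ← trans (sym q) r
  ... | false | q | r with () ← trans (sym q) r

  -- Colorings of the edges of the cycle, the edge from i to next i being i.
  Proper : (I → Fin 3) → Set
  Proper x = ∀ i → x i ≢ x (next i)

  -- "Even" means par i ≡ true: the module is used with both color classes of the
  -- cycle in the role of the even edges.
  module Bipartition (par : I → Bool) (par-next : ∀ i → par (next i) ≡ not (par i)) where

    split : (a b : I → Fin 3) → I → Fin 3
    split a b i = if par i then a i else b i

    split-proper : ∀ {a b} → (∀ i → a i ≢ b (next i)) → (∀ i → a (next i) ≢ b i) →
                   Proper (split a b)
    split-proper p q i eq with par i | par (next i) | par-next i
    ... | true  | false | _ = p i eq
    ... | false | true  | _ = q i (sym eq)

    bip : I → Fin 3
    bip = split (λ _ → 0F) (λ _ → 1F)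

    bip-proper : Proper bip
    bip-proper = split-proper (λ _ ()) (λ _ ())

    Matching : (I → Bool) → Set
    Matching A = ∀ i → A i ≡ true → A (next i) ≢ true

    -- {A, even ∖ A, odd ∖ A}
    refine : (I → Bool) → I → Fin 3
    refine A = split (λ i → if A i then 0F else 1F) (λ i → if A i then 0F else 2F)

    refine-proper : ∀ {A} → Matching A → Proper (refine A)
    refine-proper {A} ind = split-proper
      (λ i → lemma (ind i)) (λ i → lemma (λ p q → ind i q p))
      where
      lemma : ∀ {a b} → (a ≡ true → b ≢ true) →
              (if a then 0F else 1F) ≢ (if b then 0F else 2F)
      lemma {true}  {true}  p _ = p refl refl
      lemma {true}  {false} p ()
      lemma {false} {true}  p ()
      lemma {false} {false} p ()

    refine-0 : ∀ A i → (refine A i == 0F) ≡ A i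
    refine-0 A i with par i | A i
    ... | true  | true  = refl
    ... | true  | false = refl
    ... | false | true  = refl
    ... | false | false = refl

    -- In the language of social choice, `F` elects one class of each coloring, consistently across
    -- colorings, and a dictator is an edge whose class always wins.
    module Dictator (F : (x : I → Fin 3) → Proper x → Fin 3)
      (coherent : ∀ {x k x′ k′} p p′ → SameClass x k x′ k′ → F x p ≡ k → F x′ p′ ≡ k′)
      (F-bip : F bip bip-proper ≡ 0F) where

      private
        -- {even ∩ A, even ∖ A, odd}
        splitEven : (I → Bool) → I → Fin 3
        splitEven A = split (λ i → if A i then 0F else 1F) (λ _ → 2F)

        splitEven-proper : ∀ A → Proper (splitEven A)
        splitEven-proper A = split-proper (λ i → lemma (A i)) (λ i → lemma (A (next i)))
          where
          lemma : ∀ a → (if a then 0F else 1F) ≢ 2F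
          lemma true  ()
          lemma false ()

        -- {even, odd ∩ A, odd ∖ A}
        splitOdd : (I → Bool) → I → Fin 3
        splitOdd A = split (λ _ → 0F) (λ i → if A i then 1F else 2F)

        splitOdd-proper : ∀ A → Proper (splitOdd A)
        splitOdd-proper A = split-proper (λ i → lemma (A (next i))) (λ i → lemma (A i))
          where
          lemma : ∀ a → 0F ≢ (if a then 1F else 2F)
          lemma true  ()
          lemma false ()

        -- Class `2F` consists of all odd edges, which lose to the even ones in `bip`.
        F-splitEven≢2 : ∀ A → F (splitEven A) (splitEven-proper A) ≢ 2F
        F-splitEven≢2 A p = contradiction
          (trans (sym F-bip) (coherent (splitEven-proper A) bip-proper same p)) λ ()
          where
          same : SameClass (splitEven A) 2F bip 1F
          same .agree i with par i | A i
          ... | true  | true  = refl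
          ... | true  | false = refl
          ... | false | _     = refl

        F-splitOdd : ∀ A → F (splitOdd A) (splitOdd-proper A) ≡ 0F
        F-splitOdd A = coherent bip-proper (splitOdd-proper A) same F-bip
          where
          same : SameClass bip 0F (splitOdd A) 0F
          same .agree i with par i | A i
          ... | true  | _     = refl
          ... | false | true  = refl
          ... | false | false = refl

        -- Class `2F` is also class `2F` of `splitOdd A`, where the set of all even edges wins.
        F-refine≢2 : ∀ {A} (ind : Matching A) → F (refine A) (refine-proper ind) ≢ 2F
        F-refine≢2 {A} ind p = contradiction
          (trans (sym (F-splitOdd A))
            (coherent (refine-proper ind) (splitOdd-proper A) same p)) λ ()
          where
          same : SameClass (refine A) 2F (splitOdd A) 2F
          same .agree i with par i | A i
          ... | true  | true  = refl
          ... | true  | false = refl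
          ... | false | true  = refl
          ... | false | false = refl

        refine-splitEven : ∀ A → SameClass (refine A) 1F (splitEven A) 1F
        refine-splitEven A .agree i with par i | A i
        ... | true  | _     = refl
        ... | false | true  = refl
        ... | false | false = refl

        class : (I → Fin 3) → Fin 3 → I → Bool
        class x k i = x i == k

        class-matching : ∀ {x} → Proper x → ∀ k → Matching (class x k)
        class-matching p k i q r = p i (trans (==⇒≡ q) (sym (==⇒≡ r)))

        refine-class : ∀ x k → SameClass (refine (class x k)) 0F x k
        refine-class x k .agree = refine-0 (class x k)

        -- For `A` the class `k` of `x`, the colorings `refine A` and `splitEven A` share the class
        -- of even edges outside `A`, and in both the class `2F` loses. So `A` wins exactly when its
        -- even part does; `splitEven⇒F` is the converse.
        F⇒splitEven : ∀ {x k} p → F x p ≡ k →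
          F (splitEven (class x k)) (splitEven-proper (class x k)) ≡ 0F
        F⇒splitEven {x} {k} p q with
            F (splitEven (class x k)) (splitEven-proper (class x k)) in eq
        ... | 0F = refl
        ... | 2F = contradiction eq (F-splitEven≢2 (class x k))
        ... | 1F with () ← trans
          (sym (coherent p (refine-proper (class-matching p k))
            (SameClass-sym (refine-class x k)) q))
          (coherent (splitEven-proper (class x k)) (refine-proper (class-matching p k))
            (SameClass-sym (refine-splitEven (class x k))) eq)

        splitEven⇒F : ∀ {x k} p →
          F (splitEven (class x k)) (splitEven-proper (class x k)) ≡ 0F → F x p ≡ k
        splitEven⇒F {x} {k} p q with
            F (refine (class x k)) (refine-proper (class-matching p k)) in eq
        ... | 0F = coherent (refine-proper (class-matching p k)) p (refine-class x k) eq
        ... | 2F = contradiction eq (F-refine≢2 (class-matching p k))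
        ... | 1F with () ← trans (sym q)
          (coherent (refine-proper (class-matching p k)) (splitEven-proper (class x k))
            (refine-splitEven (class x k)) eq)

        -- Both neighbors of an odd edge are even, so only the even values of `y` enter. A total `y`
        -- allows `Principal` to be applied to all of `I`.
        extend : (I → Fin 3) → I → Fin 3
        extend y = split y (λ i → third (y (prev i)) (y (next i)))

        extend-proper : ∀ y → Proper (extend y)
        extend-proper y = split-proper
          (λ i p → third≢ˡ (y i) _ (trans
            (cong (λ j → third (y j) (y (next (next i)))) (sym (prev-next i))) (sym p)))
          (λ i p → third≢ʳ (y (prev i)) _ (sym p))

        splitEven-cong : ∀ {A A′} → (∀ i → par i ≡ true → A i ≡ A′ i) →
                         SameClass (splitEven A) 0F (splitEven A′) 0F
        splitEven-cong p .agree i with par i | p i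
        ... | true  | q = cong (λ b → (if b then 0F else 1F) == 0F) (q refl)
        ... | false | _ = refl

        extend-even : ∀ y i → par i ≡ true → extend y i ≡ y i
        extend-even y i p rewrite p = refl

        H : (I → Fin 3) → Fin 3
        H y = F (extend y) (extend-proper y)

        H⇒splitEven : ∀ {y k} → H y ≡ k →
          F (splitEven (class y k)) (splitEven-proper (class y k)) ≡ 0F
        H⇒splitEven {y} {k} p =
          coherent (splitEven-proper (class (extend y) k)) (splitEven-proper (class y k))
            (splitEven-cong λ i e → cong (_== k) (extend-even y i e))
            (F⇒splitEven (extend-proper y) p)

        splitEven⇒H : ∀ {y k} →
          F (splitEven (class y k)) (splitEven-proper (class y k)) ≡ 0F → H y ≡ k
        splitEven⇒H {y} {k} p = splitEven⇒F (extend-proper y)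
          (coherent (splitEven-proper (class y k)) (splitEven-proper (class (extend y) k))
            (splitEven-cong λ i e → cong (_== k) (sym (extend-even y i e))) p)

        -- The two extensions may disagree on odd edges, so coherence of `F` does not apply to them
        -- directly; passing through `splitEven` erases the odd edges.
        H-coherent : ∀ {y k y′ k′} → SameClass y k y′ k′ → H y ≡ k → H y′ ≡ k′
        H-coherent {y} {k} {y′} {k′} same p = splitEven⇒H
          (coherent (splitEven-proper (class y k)) (splitEven-proper (class y′ k′))
            (splitEven-cong λ i _ → same .agree i) (H⇒splitEven p))

        open Principal H H-coherent using (principal)

      abstract
        dictator : ∃[ i ] par i ≡ true × (∀ {x} p → F x p ≡ x i)
        dictator = i , i-even , λ p → F≡ p
          where
          i : I
          i = proj₁ principal

          F≡ : ∀ {x} p → F x p ≡ x i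
          F≡ {x} p = splitEven⇒F p (H⇒splitEven (proj₂ principal x))

          -- `principal` yields an index in all of `I`. It is even because `bip` has the winning
          -- label `0F` at even edges only.
          i-even : par i ≡ true
          i-even = lemma (par i) (trans (sym F-bip) (F≡ bip-proper))
            where
            lemma : ∀ b → _≡_ {A = Fin 3} 0F (if b then 0F else 1F) → b ≡ true
            lemma true  _ = refl
            lemma false ()

  open Bipartition par par-next

  -- Matchings with one or two edges.

  single : I → I → Bool
  single i j = j == i

  pair : I → I → I → Bool
  pair i j k = (k == i) ∨ (k == j)

  pair-matching : ∀ {i j} → j ≢ next i → i ≢ next j → Matching (pair i j)
  pair-matching {i} {j} p q k r s with k ≟ i | k ≟ j | next k ≟ i | next k ≟ j
  ... | yes refl | _        | yes t    | _        = next≢ _ t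
  ... | yes refl | _        | no _     | yes t    = p (sym t)
  ... | no _     | yes refl | yes t    | _        = q (sym t)
  ... | no _     | yes refl | no _     | yes t    = next≢ _ t

  -- Both edges lie in class `0F`. With `pair-matching`, this puts two nonconsecutive edges into one
  -- class of a proper coloring.
  refine-pair : ∀ i j → refine (pair i j) i ≡ refine (pair i j) j
  refine-pair i j = trans
    (==⇒≡ (trans (refine-0 (pair i j) i) (cong (_∨ (i == j)) (==-refl i))))
    (sym (==⇒≡ (trans (refine-0 (pair i j) j)
      (trans (cong ((j == i) ∨_) (==-refl j)) (∨-zeroʳ (j == i))))))

  single-matching : ∀ i → Matching (single i)
  single-matching i k r s = next≢ k (trans (==⇒≡ s) (sym (==⇒≡ r)))

  -- Edges of the prism and their incidences.

  Π : Graph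
  Π = Prism (suc m) 3≤n

  -- Normal forms of edges: an `Edge Π` carries an orientation and an adjacency proof, a `Line`
  -- neither, so propositional equality replaces `_≈ₑ_`.
  data Line : Set where
    rail : Fin 2 → I → Line
    rung : I → Line

  infix 4 _On_

  -- `head` takes an equation, so that matching on two incidences at one vertex need not unify
  -- applications of `next`.
  data _On_ : Graph.V Π → Line → Set where
    at   : ∀ {i s} → (i , s) On rung i
    tail : ∀ {i s} → (i , s) On rail s i
    head : ∀ {i j s} → j ≡ next i → (j , s) On rail s i

  line : Edge Π → Line
  line ((i , s) , _ , inj₁ _)                = rung i
  line ((i , s) , _ , inj₂ (inj₁ _ , _))     = rail s i
  line ((i , s) , (j , _) , inj₂ (inj₂ _ , _)) = rail s j

  edge : Line → Edge Π
  edge (rail s i) = (i , s) , (next i , s) , inj₂ (inj₁ (next-Next i) , refl)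
  edge (rung i)   = (i , 0F) , (i , 1F) , inj₁ (refl , λ ())

  line-edge : ∀ l → line (edge l) ≡ l
  line-edge (rail s i) = refl
  line-edge (rung i)   = refl

  edge-line : ∀ e → _≈ₑ_ Π e (edge (line e))
  edge-line ((i , 0F) , (_ , 0F) , inj₁ (refl , s≢t)) = contradiction refl s≢t
  edge-line ((i , 0F) , (_ , 1F) , inj₁ (refl , s≢t)) = inj₁ ((refl , refl) , (refl , refl))
  edge-line ((i , 1F) , (_ , 0F) , inj₁ (refl , s≢t)) = inj₂ ((refl , refl) , (refl , refl))
  edge-line ((i , 1F) , (_ , 1F) , inj₁ (refl , s≢t)) = contradiction refl s≢t
  edge-line (_ , _ , inj₂ (inj₁ p , refl)) = inj₁ ((refl , refl) , (Next⇒≡ p , refl))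
  edge-line (_ , _ , inj₂ (inj₂ p , refl)) = inj₂ ((Next⇒≡ p , refl) , (refl , refl))

  private
    no-loop : ∀ {i} → ¬ (Next i i ⊎ Next {suc m} i i)
    no-loop (inj₁ p) = next≢ _ (sym (Next⇒≡ p))
    no-loop (inj₂ p) = next≢ _ (sym (Next⇒≡ p))

    -- Different normal forms would require a loop or a pair of parallel edges, which `no-loop` and
    -- `Next-asym` exclude.
    line-unique : ∀ u v (a b : Graph.Adj Π u v) → line (u , v , a) ≡ line (u , v , b)
    line-unique u v (inj₁ _)          (inj₁ _)          = refl
    line-unique u v (inj₁ (refl , _)) (inj₂ (c , _))    = contradiction c no-loop
    line-unique u v (inj₂ (c , _))    (inj₁ (refl , _)) = contradiction c no-loop
    line-unique u v (inj₂ (inj₁ _ , _)) (inj₂ (inj₁ _ , _)) = refl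
    line-unique u v (inj₂ (inj₁ p , _)) (inj₂ (inj₂ q , _)) = contradiction q (Next-asym 3≤n p)
    line-unique u v (inj₂ (inj₂ p , _)) (inj₂ (inj₁ q , _)) = contradiction q (Next-asym 3≤n p)
    line-unique u v (inj₂ (inj₂ _ , _)) (inj₂ (inj₂ _ , _)) = refl

    line-flip : ∀ u v (a : Graph.Adj Π u v) (b : Graph.Adj Π v u) →
                line (u , v , a) ≡ line (v , u , b)
    line-flip u v (inj₁ (refl , _)) (inj₁ _)          = refl
    line-flip u v (inj₁ (refl , _)) (inj₂ (c , _))    = contradiction c no-loop
    line-flip u v (inj₂ (c , _))    (inj₁ (refl , _)) = contradiction c no-loop
    line-flip u v (inj₂ (inj₁ p , _)) (inj₂ (inj₁ q , _)) = contradiction q (Next-asym 3≤n p)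
    line-flip u v (inj₂ (inj₁ _ , refl)) (inj₂ (inj₂ _ , _)) = refl
    line-flip u v (inj₂ (inj₂ _ , refl)) (inj₂ (inj₁ _ , _)) = refl
    line-flip u v (inj₂ (inj₂ p , _)) (inj₂ (inj₂ q , _)) = contradiction q (Next-asym 3≤n p)

  line-cong : ∀ {e f} → _≈ₑ_ Π e f → line e ≡ line f
  line-cong {u , v , a} {_ , _ , b} (inj₁ ((refl , refl) , (refl , refl))) = line-unique u v a b
  line-cong {u , v , a} {_ , _ , b} (inj₂ ((refl , refl) , (refl , refl))) = line-flip u v a b

  incident⇒on : ∀ w e → Incident Π w e → w On line e
  incident⇒on _ (_ , _ , inj₁ (refl , _))        (inj₁ (refl , refl)) = at
  incident⇒on _ (_ , _ , inj₁ (refl , _))        (inj₂ (refl , refl)) = at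
  incident⇒on _ (_ , _ , inj₂ (inj₁ p , refl))   (inj₁ (refl , refl)) = tail
  incident⇒on _ (_ , _ , inj₂ (inj₁ p , refl))   (inj₂ (refl , refl)) = head (Next⇒≡ p)
  incident⇒on _ (_ , _ , inj₂ (inj₂ p , refl))   (inj₁ (refl , refl)) = head (Next⇒≡ p)
  incident⇒on _ (_ , _ , inj₂ (inj₂ p , refl))   (inj₂ (refl , refl)) = tail

  on⇒incident : ∀ {w l} → w On l → Incident Π w (edge l)
  on⇒incident (at {s = 0F}) = inj₁ (refl , refl)
  on⇒incident (at {s = 1F}) = inj₂ (refl , refl)
  on⇒incident tail          = inj₁ (refl , refl)
  on⇒incident (head p)      = inj₂ (p , refl)

  LΠ : Graph
  LΠ = L Π

  edge-adj : ∀ {w l l′} → w On l → w On l′ → l ≢ l′ → Graph.Adj LΠ (edge l) (edge l′)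
  edge-adj {w} {l} {l′} p q l≢l′ =
      (λ eq → l≢l′ (trans (sym (line-edge l))
                     (trans (line-cong {edge l} {edge l′} eq) (line-edge l′))))
    , w , on⇒incident p , on⇒incident q

  adj-line : ∀ e {w l} → w On line e → w On l → line e ≢ l → Graph.Adj LΠ e (edge l)
  adj-line e {l = l} p q e≢l = Graph.adj-resp LΠ {edge (line e)} {e} {edge l} {edge l}
    (Graph.≈-sym LΠ {e} {edge (line e)} (edge-line e)) (Graph.≈-refl LΠ {edge l})
    (edge-adj p q e≢l)

  -- Colorings of the line graph.

  record Valid (v : Line → Fin 3) : Set where
    field
      consecutive : ∀ s i → v (rail s i) ≢ v (rail s (next i))
      tails       : ∀ s i → v (rail s i) ≢ v (rung i)
      heads       : ∀ s i → v (rail s i) ≢ v (rung (next i))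

  open Valid

  valid⇒≢ : ∀ {v w l l′} → Valid v → w On l → w On l′ → l ≢ l′ → v l ≢ v l′
  valid⇒≢ p at          at          l≢l′ = contradiction refl l≢l′
  valid⇒≢ p at          tail        _    = ≢-sym (p .tails _ _)
  valid⇒≢ p at          (head refl) _    = ≢-sym (p .heads _ _)
  valid⇒≢ p tail        at          _    = p .tails _ _
  valid⇒≢ p tail        tail        l≢l′ = contradiction refl l≢l′
  valid⇒≢ p tail        (head refl) _    = ≢-sym (p .consecutive _ _)
  valid⇒≢ p (head refl) at          _    = p .heads _ _
  valid⇒≢ p (head refl) tail        _    = p .consecutive _ _
  valid⇒≢ p (head q)    (head r)    l≢l′ =
    contradiction (cong (rail _) (next-injective (trans (sym q) r))) l≢l′

  open ThreeColoring

  abstract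
    toColoring : ∀ {v} → Valid v → ThreeColoring LΠ
    toColoring {v} p = record
      { part        = λ k → record
        { to   = λ e → v (line e) == k
        ; cong = λ {e} {f} e≈f → cong (λ l → v l == k) (line-cong {e} {f} e≈f)
        }
      ; cover       = λ e → v (line e) , ==-refl (v (line e))
      ; disjoint    = λ {e} q r → trans (sym (==⇒≡ {a = v (line e)} q)) (==⇒≡ r)
      ; independent = λ k {e} {f} q r (e≉f , w , e∋w , f∋w) →
          valid⇒≢ p (incident⇒on w e e∋w) (incident⇒on w f f∋w)
            (λ eq → e≉f (Graph.≈-trans LΠ {e} {edge (line e)} {f} (edge-line e)
               (subst (λ l → _≈ₑ_ Π (edge l) f) (sym eq)
                 (Graph.≈-sym LΠ {f} {edge (line f)} (edge-line f)))))
            (trans (==⇒≡ q) (sym (==⇒≡ r)))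
      }

    -- With `toColoring` abstract, all later access to its parts goes through this equation.
    part-toColoring : ∀ {v} (p : Valid v) k e → part (toColoring p) k ⟨$⟩ e ≡ (v (line e) == k)
    part-toColoring p k e = refl

  colorOf : ThreeColoring LΠ → Line → Fin 3
  colorOf c l = proj₁ (cover c (edge l))

  colorOf-≢ : ∀ c {w l l′} → w On l → w On l′ → l ≢ l′ → colorOf c l ≢ colorOf c l′
  colorOf-≢ c {l = l} {l′} p q l≢l′ eq = independent c (colorOf c l)
    (proj₂ (cover c (edge l)))
    (subst (λ k → edge l′ ∈ part c k) (sym eq) (proj₂ (cover c (edge l′))))
    (edge-adj p q l≢l′)

  colorOf-valid : ∀ c → Valid (colorOf c)
  colorOf-valid c .consecutive s i = colorOf-≢ c (head refl) tail λ eq → next≢ i (lemma (sym eq))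
    where
    lemma : ∀ {s i j} → rail s i ≡ rail s j → i ≡ j
    lemma refl = refl
  colorOf-valid c .tails s i = colorOf-≢ c tail at λ ()
  colorOf-valid c .heads s i = colorOf-≢ c (head refl) at λ ()

  part-colorOf : ∀ c k e → part c k ⟨$⟩ e ≡ (colorOf c (line e) == k)
  part-colorOf c k e = trans (Func.cong (part c k) {e} {edge (line e)} (edge-line e))
    (⇔→≡ (mk⇔
      (λ p → trans (cong (_== k) (disjoint c (proj₂ (cover c (edge (line e)))) p)) (==-refl k))
      (λ p → subst (λ k → edge (line e) ∈ part c k) (==⇒≡ p) (proj₂ (cover c (edge (line e)))))))

  class : ∀ {v} → Valid v → Fin 3 → Graph.V (B LΠ)
  class p k = part (toColoring p) k , toColoring p , k , λ _ → refl

  class-edge : ∀ {v} (p : Valid v) k l → proj₁ (class p k) ⟨$⟩ edge l ≡ (v l == k)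
  class-edge {v} p k l =
    trans (part-toColoring p k (edge l)) (cong (λ l → v l == k) (line-edge l))

  -- Reduces statements about arbitrary vertices of the complex to classes of valid colorings of
  -- lines.
  class-intro : (C : Graph.V (B LΠ)) →
    ∃[ v ] ∃[ p ] ∃[ k ] (∀ e → proj₁ C ⟨$⟩ e ≡ proj₁ (class {v} p k) ⟨$⟩ e)
  class-intro (_ , c , k , eq) =
    colorOf c , colorOf-valid c , k , λ e →
      trans (eq e) (trans (part-colorOf c k e) (sym (part-toColoring (colorOf-valid c) k e)))

  -- Three lines meeting at a vertex carry all three colors. This makes the classes of a coloring
  -- distinct vertices of the complex.
  class-nonempty : ∀ {v} → Valid v → ∀ k → ∃[ l ] v l ≡ k
  class-nonempty {v} p k with distinct-exhaust (v (rail 0F zero)) (v (rail 0F (next zero)))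
      (v (rung (next zero))) k (p .consecutive _ _) (p .heads _ _) (p .tails _ _)
  ... | inj₁ q        = _ , sym q
  ... | inj₂ (inj₁ q) = _ , sym q
  ... | inj₂ (inj₂ q) = _ , sym q

  -- The two kinds of colorings.

  lift : (I → Fin 3) → Line → Fin 3
  lift x (rail _ i) = x i
  lift x (rung i)   = third (x (prev i)) (x i)

  lift-valid : ∀ {x} → Proper x → Valid (lift x)
  lift-valid p .consecutive _ i   = p i
  lift-valid {x} p .tails _ i     = ≢-sym (third≢ʳ (x (prev i)) (x i))
  lift-valid {x} p .heads _ i     = subst (λ j → x j ≢ third (x (prev (next i))) (x (next i)))
    (prev-next i) (≢-sym (third≢ˡ (x (prev (next i))) (x (next i))))

  prev-≢ : ∀ {x} → Proper x → ∀ i → x (prev i) ≢ x i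
  prev-≢ {x} p i = subst (λ j → x (prev i) ≢ x j) (next-prev i) (p (prev i))

  abstract
    third-class : ∀ a b k → a ≢ b → (third a b == k) ≡ not ((a == k) ∨ (b == k))
    third-class = toWitness {a? = all? λ a → all? λ b → all? λ k →
      ¬? (a ≟ b) →-dec ((third a b == k) Bool.≟ not ((a == k) ∨ (b == k)))} _

  bip-valid : Valid (lift bip)
  bip-valid = lift-valid bip-proper

  bip-rung : ∀ i → lift bip (rung i) ≡ 2F
  bip-rung i = third-unique (prev-≢ bip-proper i) (bip≢2 (prev i)) (bip≢2 i)
    where
    bip≢2 : ∀ i → 2F ≢ bip i
    bip≢2 i with par i
    ... | true  = λ ()
    ... | false = λ ()

  -- By `third-class`, a rung belongs to a class exactly when neither of the adjacent positions of
  -- the cycle does.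
  lift-agree : ∀ {x k x′ k′} → Proper x → Proper x′ →
               SameClass x k x′ k′ → SameClass (lift x) k (lift x′) k′
  lift-agree p p′ q .agree (rail _ i) = q .agree i
  lift-agree {x} {k} {x′} {k′} p p′ q .agree (rung i) =
    trans (third-class _ _ k (prev-≢ p i))
      (trans (cong₂ (λ a b → not (a ∨ b)) (q .agree (prev i)) (q .agree i))
        (sym (third-class _ _ k′ (prev-≢ p′ i))))

  -- One representative of the second kind suffices: by `lift-or-twist`, the others differ only in
  -- the names of the colors.
  twist : Line → Fin 3
  twist (rail 0F i) = if par i then 0F else 1F
  twist (rail 1F i) = if par i then 1F else 0F
  twist (rung i)    = 2F

  twist-valid : Valid twist
  twist-valid .consecutive 0F i p with par i | par (next i) | par-next i
  twist-valid .consecutive 0F i () | true  | _ | refl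
  twist-valid .consecutive 0F i () | false | _ | refl
  twist-valid .consecutive 1F i p with par i | par (next i) | par-next i
  twist-valid .consecutive 1F i () | true  | _ | refl
  twist-valid .consecutive 1F i () | false | _ | refl
  twist-valid .tails 0F i p with par i
  twist-valid .tails 0F i () | true
  twist-valid .tails 0F i () | false
  twist-valid .tails 1F i p with par i
  twist-valid .tails 1F i () | true
  twist-valid .tails 1F i () | false
  twist-valid .heads 0F i p with par i
  twist-valid .heads 0F i () | true
  twist-valid .heads 0F i () | false
  twist-valid .heads 1F i p with par i
  twist-valid .heads 1F i () | true
  twist-valid .heads 1F i () | false

  twist-rails : ∀ i → twist (rail 0F i) ≢ twist (rail 1F i)
  twist-rails i with par i
  ... | true  = λ ()
  ... | false = λ ()

  twist-rail≢2 : ∀ s i → twist (rail s i) ≢ 2F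
  twist-rail≢2 0F i with par i
  ... | true  = λ ()
  ... | false = λ ()
  twist-rail≢2 1F i with par i
  ... | true  = λ ()
  ... | false = λ ()

  twist-onto : ∀ i k → k ≢ 2F → ∃[ s ] twist (rail s i) ≡ k
  twist-onto i k k≢2 with distinct-exhaust (twist (rail 0F i)) (twist (rail 1F i)) 2F k
      (twist-rails i) (twist-rail≢2 0F i) (twist-rail≢2 1F i)
  ... | inj₁ p        = 0F , sym p
  ... | inj₂ (inj₁ p) = 1F , sym p
  ... | inj₂ (inj₂ p) = contradiction p k≢2

  twist-next : ∀ i → twist (rail 0F i) ≡ twist (rail 1F (next i)) ×
                     twist (rail 1F i) ≡ twist (rail 0F (next i))
  twist-next i with par i | par (next i) | par-next i
  ... | true  | _ | refl = refl , refl
  ... | false | _ | refl = refl , refl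

  private
    -- For distinct `a` and `b` a permutation of the colors, renaming those of `twist` to the ones
    -- found on the rails at `zero`.
    relabel : Fin 3 → Fin 3 → Fin 3 → Fin 3
    relabel a b 0F = a
    relabel a b 1F = b
    relabel a b 2F = third a b

    abstract
      relabel-== : ∀ a b j k → a ≢ b → (j == k) ≡ (relabel a b j == relabel a b k)
      relabel-== = toWitness {a? = all? λ a → all? λ b → all? λ j → all? λ k →
        ¬? (a ≟ b) →-dec ((j == k) Bool.≟ (relabel a b j == relabel a b k))} _

    relabel-injective : ∀ {a b j k} → a ≢ b → relabel a b j ≡ relabel a b k → j ≡ k
    relabel-injective {a} {b} {j} {k} a≢b eq = ==⇒≡ (trans (relabel-== a b j k a≢b)
      (trans (cong (_== relabel a b k) eq) (==-refl (relabel a b k))))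

    abstract
      relabel-third : ∀ a b j k → a ≢ b → j ≢ k → j ≢ 2F → k ≢ 2F →
                      third (relabel a b j) (relabel a b k) ≡ third a b
      relabel-third = toWitness {a? = all? λ a → all? λ b → all? λ j → all? λ k →
        ¬? (a ≟ b) →-dec ¬? (j ≟ k) →-dec ¬? (j ≟ 2F) →-dec ¬? (k ≟ 2F) →-dec
        (third (relabel a b j) (relabel a b k) ≟ third a b)} _

  -- The colors of the two rails at one position determine the whole coloring:
  -- if they agree there, they agree everywhere, and otherwise they get swapped
  -- at each rung.
  lift-or-twist : ∀ {v} → Valid v →
    (∃[ x ] Proper x × (∀ l → v l ≡ lift x l)) ⊎
    (∀ l l′ → (twist l == twist l′) ≡ (v l == v l′))
  lift-or-twist {v} p with v (rail 0F zero) ≟ v (rail 1F zero)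
  ... | yes eq = inj₁ (x , p .consecutive 0F , v≡lift)
    where
    x : I → Fin 3
    x i = v (rail 0F i)

    -- On both rails the next color avoids the same two colors, that of the current rails and that
    -- of the rung they reach.
    same : ∀ i → v (rail 0F i) ≡ v (rail 1F i)
    same = next-induction _ eq λ i q → remaining-unique (x i) (v (rung (next i))) _ _
      (p .heads 0F i) (≢-sym (p .consecutive 0F i)) (p .tails 0F (next i))
      (λ r → p .consecutive 1F i (trans (sym q) (sym r))) (p .tails 1F (next i))

    v≡lift : ∀ l → v l ≡ lift x l
    v≡lift (rail 0F i) = refl
    v≡lift (rail 1F i) = sym (same i)
    v≡lift (rung i) = sym (third-unique (prev-≢ {x} (p .consecutive 0F) i)
      (λ r → p .heads 0F (prev i) (sym (trans (cong (v ∘ rung) (next-prev i)) r)))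
      (≢-sym (p .tails 0F i)))
  ... | no a≢b = inj₂ λ l l′ → trans (relabel-== a b (twist l) (twist l′) a≢b)
                   (cong₂ _==_ (sym (v≡ l)) (sym (v≡ l′)))
    where
    a b : Fin 3
    a = v (rail 0F zero)
    b = v (rail 1F zero)

    Swapping : I → Set
    Swapping i = v (rail 0F i) ≡ relabel a b (twist (rail 0F i)) ×
                 v (rail 1F i) ≡ relabel a b (twist (rail 1F i))

    rails-differ : ∀ {i} → Swapping i → v (rail 0F i) ≢ v (rail 1F i)
    rails-differ {i} (q , r) s =
      twist-rails i (relabel-injective a≢b (trans (sym q) (trans s r)))

    -- The color of the opposite rail avoids the same two colors as the next rail: that of the
    -- current rail and that of the rung ahead.
    swap : ∀ i → Swapping i →
           v (rail 0F (next i)) ≡ v (rail 1F i) × v (rail 1F (next i)) ≡ v (rail 0F i)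
    swap i s =
        remaining-unique (v (rail 0F i)) (v (rung (next i))) _ _ (p .heads 0F i)
          (≢-sym (p .consecutive 0F i)) (p .tails 0F (next i))
          (≢-sym (rails-differ s)) (p .heads 1F i)
      , remaining-unique (v (rail 1F i)) (v (rung (next i))) _ _ (p .heads 1F i)
          (≢-sym (p .consecutive 1F i)) (p .tails 1F (next i))
          (rails-differ s) (p .heads 0F i)

    swapping : ∀ i → Swapping i
    swapping = next-induction Swapping (refl , refl) step
      where
      step : ∀ i → Swapping i → Swapping (next i)
      step i s@(q , r) =
          trans (proj₁ (swap i s)) (trans r (cong (relabel a b) (proj₂ (twist-next i))))
        , trans (proj₂ (swap i s)) (trans q (cong (relabel a b) (proj₁ (twist-next i))))

    v≡ : ∀ l → v l ≡ relabel a b (twist l)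
    v≡ (rail 0F i) = proj₁ (swapping i)
    v≡ (rail 1F i) = proj₂ (swapping i)
    v≡ (rung i) = trans
      (sym (third-unique (rails-differ (swapping i))
        (≢-sym (p .tails 0F i)) (≢-sym (p .tails 1F i))))
      (trans (cong₂ third (proj₁ (swapping i)) (proj₂ (swapping i)))
        (relabel-third a b _ _ a≢b (twist-rails i) (twist-rail≢2 0F i) (twist-rail≢2 1F i)))

  -- Colorings of the 3-coloring complex.

  module _ (c : ThreeColoring (B LΠ)) where

    private
      f : ∀ {v} → Valid v → Fin 3 → Fin 3
      f p k = proj₁ (cover c (class p k))

      class∈f : ∀ {v} (p : Valid v) k → class p k ∈ part c (f p k)
      class∈f p k = proj₂ (cover c (class p k))

      f-agree : ∀ {v k v′ k′} (p : Valid v) (p′ : Valid v′) →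
                SameClass v k v′ k′ → f p k ≡ f p′ k′
      f-agree {k = k} {k′ = k′} p p′ q = disjoint c {class p k} (class∈f p k)
        (trans (Func.cong (part c (f p′ k′)) {class p k} {class p′ k′}
                 (λ e → trans (part-toColoring p k e)
                   (trans (q .agree (line e)) (sym (part-toColoring p′ k′ e)))))
          (class∈f p′ k′))

      -- The classes of one coloring are nonempty and disjoint, hence distinct and pairwise adjacent
      -- in the complex.
      f-injective : ∀ {v} (p : Valid v) {k k′} → f p k ≡ f p k′ → k ≡ k′
      f-injective {v} p {k} {k′} eq with k ≟ k′
      ... | yes k≡k′ = k≡k′
      ... | no k≢k′ = contradiction
        ( (λ same → let (l , q) = class-nonempty p k in k≢k′ (trans (sym q) (==⇒≡
            (trans (sym (class-edge p k′ l)) (trans (sym (same (edge l)))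
              (trans (class-edge p k l) (trans (cong (_== k) q) (==-refl k))))))))
        , toColoring p , (k , λ _ → refl) , (k′ , λ _ → refl))
        (independent c (f p k) {class p k} {class p k′} (class∈f p k)
          (subst (λ j → class p k′ ∈ part c j) (sym eq) (class∈f p k′)))

      f-surjective : ∀ {v} (p : Valid v) t → ∃[ k ] f p k ≡ t
      f-surjective p t with distinct-exhaust (f p 0F) (f p 1F) (f p 2F) t
          (λ q → contradiction (f-injective p q) λ ())
          (λ q → contradiction (f-injective p q) λ ())
          (λ q → contradiction (f-injective p q) λ ())
      ... | inj₁ q        = 0F , sym q
      ... | inj₂ (inj₁ q) = 1F , sym q
      ... | inj₂ (inj₂ q) = 2F , sym q

      ConstantOn : (∀ {x} → Proper x → Fin 3) → Fin 3 → Set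
      ConstantOn g t = ∀ {x} (p : Proper x) → f (lift-valid p) (g p) ≡ t

      module Dictators (t : Fin 3) where

        F : (x : I → Fin 3) → Proper x → Fin 3
        F x p = proj₁ (f-surjective (lift-valid p) t)

        f-F : ∀ {x} (p : Proper x) → f (lift-valid p) (F x p) ≡ t
        f-F p = proj₂ (f-surjective (lift-valid p) t)

        F-unique : ∀ {x k} (p : Proper x) → f (lift-valid p) k ≡ t → F x p ≡ k
        F-unique p q = f-injective (lift-valid p) (trans (f-F p) (sym q))

        F-coherent : ∀ {x k x′ k′} p p′ → SameClass x k x′ k′ → F x p ≡ k → F x′ p′ ≡ k′
        F-coherent {k = k} p p′ same q = F-unique p′
          (trans (sym (f-agree (lift-valid p) (lift-valid p′) (lift-agree p p′ same)))
            (subst (λ k → f (lift-valid p) k ≡ t) q (f-F p)))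

        abstract
          even-dictator : f bip-valid 0F ≡ t →
            ∃[ i ] par i ≡ true × ConstantOn (λ {x} _ → x i) t
          even-dictator q =
            let (i , i-even , F≡) = Dictator.dictator F F-coherent (F-unique bip-proper q) in
            i , i-even , λ p → subst (λ k → f (lift-valid p) k ≡ t) (F≡ p) (f-F p)

          odd-dictator : f bip-valid 1F ≡ t →
            ∃[ i ] not (par i) ≡ true × ConstantOn (λ {x} _ → x i) t
          odd-dictator q =
            let (i , i-odd , F≡) = Odd.Dictator.dictator F F-coherent
                  (F-coherent bip-proper Odd.bip-proper same (F-unique bip-proper q)) in
            i , i-odd , λ p → subst (λ k → f (lift-valid p) k ≡ t) (F≡ p) (f-F p)
            where
            -- Reversing the parity lets the odd edges play the even role; the resulting `bip` is
            -- the original one with `0F` and `1F` exchanged.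
            module Odd = Bipartition (not ∘ par) (λ i → cong not (par-next i))
            same : SameClass bip 1F Odd.bip 0F
            same .agree i with par i
            ... | true  = refl
            ... | false = refl

      open Dictators

      -- By `f-injective` this makes part `t` of `c` the star of `edge l`; see `part-is-star`.
      Represents : Fin 3 → Line → Set
      Represents t l = ∀ {v} (p : Valid v) → f p (v l) ≡ t

      -- By `lift-or-twist`, any coloring that is not a lift has the same classes as `twist`, so a
      -- single check covers the second kind.
      represents : ∀ {t} l → ConstantOn (λ {x} _ → lift x l) t →
                   f twist-valid (twist l) ≡ t → Represents t l
      represents l q r p with lift-or-twist p
      ... | inj₁ (x , px , v≡) = trans (f-agree p (lift-valid px) same) (q px)
        where
        same : SameClass _ _ (lift x) (lift x l)
        same .agree l′ = cong₂ _==_ (v≡ l′) (v≡ l)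
      ... | inj₂ s = trans (f-agree p twist-valid (sameClass λ l′ → sym (s l′ l))) r

      -- Both classes are the set of all rungs. This vertex of the complex links the two kinds of
      -- colorings.
      f-twist-2 : f twist-valid 2F ≡ f bip-valid 2F
      f-twist-2 = f-agree twist-valid bip-valid same
        where
        same : SameClass twist 2F (lift bip) 2F
        same .agree (rail 0F i) with par i
        ... | true  = refl
        ... | false = refl
        same .agree (rail 1F i) with par i
        ... | true  = refl
        ... | false = refl
        same .agree (rung i) = sym (cong (_== 2F) (bip-rung i))

      -- In `twist` the class of color `t` is not the class of rungs, so its label occurs on one of
      -- the two rails over `i`, and that rail is taken.
      rail-represents : ∀ {t} i → f bip-valid 2F ≢ t → ConstantOn (λ {x} _ → x i) t →
                        ∃[ l ] Represents t l
      rail-represents {t} i t≢ q with f-surjective twist-valid t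
      ... | k , r with twist-onto i k (λ { refl → t≢ (trans (sym f-twist-2) r) })
      ... | s , eq = rail s i , represents (rail s i) q (trans (cong (f twist-valid) eq) r)

      -- In a lift the rails meeting this rung lie in the classes of colors `t` and `t′`, which
      -- leaves the third color for the rung. In `twist` the class of all rungs has that color.
      rung-represents : ∀ {t t′} i → f bip-valid 2F ≢ t → f bip-valid 2F ≢ t′ →
        ConstantOn (λ {x} _ → x i) t → ConstantOn (λ {x} _ → x (next i)) t′ →
        Represents (f bip-valid 2F) (rung (next i))
      rung-represents i ≢t ≢t′ q q′ = represents (rung (next i)) constant f-twist-2
        where
        constant : ConstantOn (λ {x} _ → lift x (rung (next i))) (f bip-valid 2F)
        constant {x} p with f-surjective (lift-valid p) (f bip-valid 2F)
        ... | k , r = trans (cong (f (lift-valid p)) (trans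
            (cong (λ j → third (x j) (x (next i))) (prev-next i))
            (third-unique (p i)
              (λ { refl → ≢t (trans (sym r) (q p)) })
              (λ { refl → ≢t′ (trans (sym r) (q′ p)) })))) r

      bip-f-≢ : ∀ {k k′} → k ≢ k′ → f bip-valid k ≢ f bip-valid k′
      bip-f-≢ k≢k′ eq = k≢k′ (f-injective bip-valid eq)

      third-represents : ∃[ l ] Represents (f bip-valid 2F) l
      third-represents with even-dictator (f bip-valid 0F) refl | odd-dictator (f bip-valid 1F) refl
      ... | i , _ , q | j , _ , r with j ≟ next i | i ≟ next j
      ... | yes refl | _ = rung (next i) , rung-represents i (bip-f-≢ λ ()) (bip-f-≢ λ ()) q r
      ... | no _ | yes refl = rung (next j) , rung-represents j (bip-f-≢ λ ()) (bip-f-≢ λ ()) r q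
      -- Nonconsecutive dictators would share a class of `refine (pair i j)`, and this class would
      -- have two colors.
      ... | no j≢ | no i≢ = contradiction
        (trans (sym (q pr)) (trans (cong (f (lift-valid pr)) (refine-pair i j)) (r pr)))
        (bip-f-≢ λ ())
        where
        pr : Proper (refine (pair i j))
        pr = refine-proper (pair-matching j≢ i≢)

      representative : ∀ t → ∃[ l ] Represents t l
      representative t with f-surjective bip-valid t
      ... | 0F , refl = let (i , _ , q) = even-dictator t refl in
        rail-represents i (bip-f-≢ λ ()) q
      ... | 1F , refl = let (i , _ , q) = odd-dictator t refl in
        rail-represents i (bip-f-≢ λ ()) q
      ... | 2F , refl = third-represents

    -- This is the surjectivity of the canonical map.
    part-is-star : ∀ t → ∃[ l ] (∀ C → proj₁ C ⟨$⟩ edge l ≡ part c t ⟨$⟩ C)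
    part-is-star t with representative t
    ... | l , rep = l , star≡
      where
      star≡ : ∀ C → proj₁ C ⟨$⟩ edge l ≡ part c t ⟨$⟩ C
      star≡ C with class-intro C
      ... | v , p , k , C≐ = trans (C≐ (edge l)) (trans (class-edge p k l)
        (trans (⇔→≡ (mk⇔ to from))
          (sym (Func.cong (part c t) {C} {class p k} C≐))))
        where
        to : (v l == k) ≡ true → class p k ∈ part c t
        to q = subst (λ j → class p k ∈ part c j)
          (trans (cong (f p) (sym (==⇒≡ q))) (rep p)) (class∈f p k)
        from : class p k ∈ part c t → (v l == k) ≡ true
        from q = trans (cong (_== k) (f-injective p (trans (rep p)
          (sym (disjoint c {class p k} (class∈f p k) q))))) (==-refl k)

  -- Colorings that separate lines and detect incidence.

  refine-single : ∀ i j → (refine (single i) j == 0F) ≡ (j == i)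
  refine-single i = refine-0 (single i)

  -- Class `0F` consists of both rails over `i` and all rungs that do not meet them.
  singleton : I → Line → Fin 3
  singleton i = lift (refine (single i))

  singleton-proper : ∀ i → Proper (refine (single i))
  singleton-proper i = refine-proper (single-matching i)

  singleton-valid : ∀ i → Valid (singleton i)
  singleton-valid i = lift-valid (singleton-proper i)

  singleton-self : ∀ s i → singleton i (rail s i) ≡ 0F
  singleton-self s i = ==⇒≡ (trans (refine-single i i) (==-refl i))

  singleton-other : ∀ s {i j} → j ≢ i → singleton i (rail s j) ≢ 0F
  singleton-other s {i} {j} j≢i eq
    with () ← trans (sym (==-false j≢i)) (trans (sym (refine-single i j)) (cong (_== 0F) eq))

  singleton-rung : ∀ {i j} → j ≢ i → j ≢ next i → singleton i (rung j) ≡ 0F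
  singleton-rung {i} {j} p q = third-unique (prev-≢ (singleton-proper i) j)
    (≢-sym (singleton-other 0F λ eq → q (trans (sym (next-prev j)) (cong next eq))))
    (≢-sym (singleton-other 0F p))

  singleton-rung-self : ∀ i → singleton i (rung i) ≢ 0F
  singleton-rung-self i eq = singleton-valid i .tails 0F i (trans (singleton-self 0F i) (sym eq))

  bip-rail≢rung : ∀ s i j → lift bip (rail s i) ≢ lift bip (rung j)
  bip-rail≢rung s i j eq with par i | trans eq (bip-rung j)
  ... | true  | ()
  ... | false | ()

  private
    rungs-separated : ∀ {i j} → i ≢ j → j ≢ next i →
                      singleton i (rung i) ≢ singleton i (rung j)
    rungs-separated {i} i≢j q eq =
      singleton-rung-self i (trans eq (singleton-rung (≢-sym i≢j) q))

  -- Rails over different positions are told apart by `singleton`, rails over the same position by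
  -- `twist`, a rail and a rung by `bip`, and two rungs by `singleton`.
  separated : ∀ l l′ → (∀ {v} → Valid v → v l ≡ v l′) → l ≡ l′
  separated (rail s i) (rail t j) h with i ≟ j
  ... | no i≢j = contradiction
    (trans (sym (h (singleton-valid i))) (singleton-self s i)) (singleton-other t (≢-sym i≢j))
  separated (rail 0F i) (rail 0F i) h | yes refl = refl
  separated (rail 1F i) (rail 1F i) h | yes refl = refl
  separated (rail 0F i) (rail 1F i) h | yes refl = contradiction (h twist-valid) (twist-rails i)
  separated (rail 1F i) (rail 0F i) h | yes refl =
    contradiction (sym (h twist-valid)) (twist-rails i)
  separated (rail s i) (rung j) h = contradiction (h bip-valid) (bip-rail≢rung s i j)
  separated (rung j) (rail s i) h = contradiction (sym (h bip-valid)) (bip-rail≢rung s i j)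
  separated (rung i) (rung j) h with i ≟ j | j ≟ next i
  ... | yes refl | _     = refl
  ... | no i≢j   | no q  = contradiction (h (singleton-valid i)) (rungs-separated i≢j q)
  -- Both rungs meet the rails over `i`, so `singleton i` need not tell them apart. `singleton j`
  -- does, because `i` is not `next j` in a cycle of length at least three.
  ... | no i≢j   | yes q = contradiction (sym (h (singleton-valid j)))
    (rungs-separated (≢-sym i≢j) λ i≡ → next-next≢ i (sym (trans i≡ (cong next q))))

  private
    consecutive-meet : ∀ s t i → (∀ {v} → Valid v → v (rail s i) ≢ v (rail t (next i))) →
      ∃[ w ] w On rail s i × w On rail t (next i)
    consecutive-meet 0F 0F i h = _ , head refl , tail
    consecutive-meet 1F 1F i h = _ , head refl , tail
    consecutive-meet 0F 1F i h = contradiction (proj₁ (twist-next i)) (h twist-valid)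
    consecutive-meet 1F 0F i h = contradiction (proj₂ (twist-next i)) (h twist-valid)

    rail-rung-meet : ∀ s i j → (∀ {v} → Valid v → v (rail s i) ≢ v (rung j)) →
      ∃[ w ] w On rail s i × w On rung j
    rail-rung-meet s i j h with j ≟ i | j ≟ next i
    ... | yes refl | _        = _ , tail , at
    ... | no _     | yes refl = _ , head refl , at
    ... | no p     | no q     = contradiction
      (trans (singleton-self s i) (sym (singleton-rung p q))) (h (singleton-valid i))

  -- Contrapositively, disjoint lines share a color somewhere: `bip` handles two rungs or two rails
  -- over one position, `singleton` a rail and a rung, `twist` consecutive positions on different
  -- rails, and `refine (pair i j)` the remaining rails.
  meet : ∀ l l′ → (∀ {v} → Valid v → v l ≢ v l′) → ∃[ w ] w On l × w On l′
  meet (rail s i) (rung j) h = rail-rung-meet s i j h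
  meet (rung j) (rail s i) h with rail-rung-meet s i j (λ p → ≢-sym (h p))
  ... | w , p , q = w , q , p
  meet (rung i) (rung j) h =
    contradiction (trans (bip-rung i) (sym (bip-rung j))) (h bip-valid)
  meet (rail s i) (rail t j) h with i ≟ j | j ≟ next i | i ≟ next j
  ... | yes refl | _ | _ = contradiction refl (h bip-valid)
  ... | no _ | yes refl | _ = consecutive-meet s t i h
  ... | no _ | no _ | yes refl with consecutive-meet t s j (λ p → ≢-sym (h p))
  ... | w , p , q = w , q , p
  meet (rail s i) (rail t j) h | no _ | no j≢ | no i≢ =
    contradiction (refine-pair i j) (h (lift-valid (refine-proper (pair-matching j≢ i≢))))

  -- The canonical map is an isomorphism.

  threeEdgeColorable : ThreeEdgeColorable Π
  threeEdgeColorable = toColoring bip-valid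

  noIsolated : NoIsolated LΠ
  noIsolated e = neighbor (line e) refl
    where
    neighbor : ∀ l → line e ≡ l → ∃[ e′ ] Graph.Adj LΠ e e′
    neighbor (rail s i) eq = edge (rung i) ,
      adj-line e (subst ((i , s) On_) (sym eq) tail) at (λ p → contradiction (trans (sym eq) p) λ ())
    neighbor (rung i) eq = edge (rail 0F i) ,
      adj-line e (subst ((i , 0F) On_) (sym eq) at) tail (λ p → contradiction (trans (sym eq) p) λ ())

  φ-injective : ∀ {e e′} → (∀ C → star LΠ e ⟨$⟩ C ≡ star LΠ e′ ⟨$⟩ C) → _≈ₑ_ Π e e′
  φ-injective {e} {e′} h = Graph.≈-trans LΠ {e} {edge (line e)} {e′} (edge-line e)
    (subst (λ l → _≈ₑ_ Π (edge l) e′) (sym (separated (line e) (line e′) same))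
      (Graph.≈-sym LΠ {e′} {edge (line e′)} (edge-line e′)))
    where
    same : ∀ {v} → Valid v → v (line e) ≡ v (line e′)
    -- The two stars are compared at the class that contains `e`.
    same {v} p = sym (==⇒≡ (trans (sym (part-toColoring p _ e′))
      (trans (sym (h (class p (v (line e)))))
        (trans (part-toColoring p _ e) (==-refl (v (line e)))))))

  -- Adjacent stars are different parts of one coloring, hence disjoint: no class contains both
  -- edges, and `meet` applies.
  φ-reflects : ∀ {e e′} → Graph.Adj (B (B LΠ)) (φ LΠ noIsolated e) (φ LΠ noIsolated e′) →
               Graph.Adj LΠ e e′
  φ-reflects {e} {e′} (e≄e′ , c , (i , e≐) , (j , e′≐)) with meet (line e) (line e′) differ
    where
    differ : ∀ {v} → Valid v → v (line e) ≢ v (line e′)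
    differ {v} p eq = e≄e′ λ C → trans (e≐ C) (trans
      (cong (λ k → part c k ⟨$⟩ C) (disjoint c {D}
        (trans (sym (e≐ D)) (trans (part-toColoring p _ e) (==-refl (v (line e)))))
        (trans (sym (e′≐ D)) (trans (part-toColoring p _ e′)
          (trans (cong (_== v (line e)) (sym eq)) (==-refl (v (line e))))))))
      (sym (e′≐ C)))
      where
      D : Graph.V (B LΠ)
      D = class p (v (line e))
  ... | w , p , q = Graph.adj-resp LΠ {e} {e} {edge (line e′)} {e′}
    (Graph.≈-refl LΠ {e}) (Graph.≈-sym LΠ {e′} {edge (line e′)} (edge-line e′))
    (adj-line e p q λ eq → e≄e′ λ (C , _) → Func.cong C {e} {e′}
      (Graph.≈-trans LΠ {e} {edge (line e)} {e′} (edge-line e)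
        (subst (λ l → _≈ₑ_ Π (edge l) e′) (sym eq)
          (Graph.≈-sym LΠ {e′} {edge (line e′)} (edge-line e′)))))

  edgeReflexive : EdgeReflexive Π
  edgeReflexive = threeEdgeColorable , record
    { threeColorable = threeEdgeColorable
    ; noIsolated     = noIsolated
    ; φ-isomorphism  = record
      { isHomomorphism = φ-isHomomorphism LΠ threeEdgeColorable noIsolated
      ; bijective      =
          (λ {e} {e′} → φ-injective {e} {e′})
        , λ (S , c , t , S≐) → let (l , star≡) = part-is-star c t in
            edge l , λ {e} e≈ C → trans (Func.cong (proj₁ C) {e} {edge l} e≈)
                                    (trans (star≡ C) (sym (S≐ C)))
      ; reflects       = λ {e} {e′} → φ-reflects {e} {e′}
      }
    }

theorem17 : (n : ℕ) (4≤n : 4 ≤ n) → 2 ∣ n → EdgeReflexive (Prism n (<⇒≤ 4≤n))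
theorem17 (suc m) 4≤n (divides k eq) =
  EvenCycle.edgeReflexive (<⇒≤ 4≤n) (trans (cong even eq) (even-2* k))
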